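{- The only limit point of $\lambda_{2,n}(1)$ is $1$, and the only limit point of $\lambda_{2,n}(2)$ is $3$; that is, $\{v:\lambda_{2,n}(1)=v\text{ for infinitely many odd } n>1\}=\{1\}$ and $\{v:\lambda_{2,n}(2)=v\text{ for infinitely many odd } n>1\}=\{3\}$.
   Context: For an odd integer $n>1$, a representation of a positive integer $k$ (with respect to $2$ and $n$) is an expression $k=\sum_{j\ge 0}\varepsilon_j(2)2^j+\sum_{j\ge 0}\varepsilon_j(n)n^j$ with only finitely many nonzero coefficients, where $\varepsilon_j(2)\in\{0,\pm1\}$ and $\varepsilon_j(n)\in\{0,\pm1,\dots,\pm\lfloor n/2\rfloor\}$ are integers. Its length is $\sum_{j\ge 0}(|\varepsilon_j(2)|+|\varepsilon_j(n)|)$. For a positive integer $h$, $\lambda_{2,n}(h)$ denotes the smallest positive integer that has a representation of length $h$ but no representation of length less than $h$. For fixed $h$, a limit point of $\lambda_{2,n}(h)$ is a value that $\lambda_{2,n}(h)$ takes for infinitely many $n$ as $n$ runs over the odd integers greater than $1$. -}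

module Defs where

open import Algebra.Definitions.RawMonoid using (sum)
open import Data.Fin using (toℕ)
open import Data.Integer as ℤ using (ℤ; +_; 0ℤ; ∣_∣)
open import Data.Nat as ℕ using (ℕ; _+_; _^_; _/_; _≤_; _<_)
open import Data.Nat.Divisibility using (_∤_)
open import Data.Product using (_×_; ∃-syntax)
open import Relation.Binary.PropositionalEquality using (_≡_)
open import Relation.Nullary using (¬_)

-- A finitely supported sequence of integer coefficients of absolute value
-- at most c.  The sums below do not depend on the choice of `bound`, since all
-- coefficients from `bound` on vanish.
record Coefficients (c : ℕ) : Set where
  field
    ε         : ℕ → ℤ
    bound     : ℕ
    vanishing : ∀ j → bound ≤ j → ε j ≡ 0ℤ
    bounded   : ∀ j → ∣ ε j ∣ ≤ c

  value : ℕ → ℤ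
  value b = sum ℤ.+-0-rawMonoid {bound} λ j → ε (toℕ j) ℤ.* (+ (b ^ toℕ j))

  weight : ℕ
  weight = sum ℕ.+-0-rawMonoid {bound} λ j → ∣ ε (toℕ j) ∣

record Representation (n k : ℕ) : Set where
  field
    binary : Coefficients 1
    n-ary  : Coefficients (n / 2)

  open Coefficients

  field
    represents : + k ≡ value binary 2 ℤ.+ value n-ary n

  len : ℕ
  len = weight binary + weight n-ary

HasRepresentationOfLength : (n k l : ℕ) → Set
HasRepresentationOfLength n k l = ∃[ r ] Representation.len {n} {k} r ≡ l

HasMinimalLength : (n k h : ℕ) → Set
HasMinimalLength n k h =
  HasRepresentationOfLength n k h ×
  (∀ l → l < h → ¬ HasRepresentationOfLength n k l)

-- The graph of λ₂,ₙ: the assertion that λ₂,ₙ(h) exists and equals v.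
λ₂,_⟨_⟩≔_ : (n h v : ℕ) → Set
λ₂, n ⟨ h ⟩≔ v =
  (0 < v × HasMinimalLength n v h) ×
  (∀ k → 0 < k → HasMinimalLength n k h → v ≤ k)

InfinitelyMany : (ℕ → Set) → Set
InfinitelyMany P = ∀ N → ∃[ n ] N ≤ n × P n

LimitPoint : (h v : ℕ) → Set
LimitPoint h v = InfinitelyMany λ n → 1 < n × 2 ∤ n × λ₂, n ⟨ h ⟩≔ v

{-# OPTIONS --safe #-}
module Submission where

-- A representation of length 1 is, up to sign, a single power of 2 or of n.  Since 1 and 2 are
-- powers of 2, while 3 = 1 + 2 is neither a power of 2 nor, once n > 3, a power of n, λ₂,ₙ(1) = 1
-- for all n and λ₂,ₙ(2) = 3 for n > 3; an eventually constant sequence has one limit point.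

open import Algebra.Definitions.RawMonoid using (sum)
open import Data.Bool using (Bool; true; false)
open import Data.Fin using (Fin; zero; suc; toℕ)
open import Data.Integer as ℤ using (ℤ; +_; 0ℤ; 1ℤ; ∣_∣)
import Data.Integer.Properties as ℤₚ
open import Data.List using (List; []; _∷_; length)
open import Data.Nat as ℕ using (ℕ; zero; suc; _+_; _*_; _^_; _≤_; _<_; z≤n; s≤s; z<s; s<s)
open import Data.Nat.Divisibility
open import Data.Nat.Properties
open import Data.Product using (_×_; _,_; ∃-syntax)
open import Data.Sum using (_⊎_; inj₁; inj₂)
open import Function.Bundles using (_⇔_; mk⇔)
open import Relation.Binary.PropositionalEquality using (_≡_; _≢_; refl; sym; trans; cong; cong₂; subst)
open import Relation.Nullary using (¬_; contradiction)
open import Relation.Nullary.Decidable using (from-no)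
open import Defs

weightedSum-zero : ∀ {m} (f w : Fin m → ℤ) →
  sum ℕ.+-0-rawMonoid (λ j → ∣ f j ∣) ≡ 0 →
  sum ℤ.+-0-rawMonoid (λ j → f j ℤ.* w j) ≡ 0ℤ
weightedSum-zero {zero}  f w eq = refl
weightedSum-zero {suc m} f w eq = cong₂ ℤ._+_
  (cong (ℤ._* w zero) (ℤₚ.∣i∣≡0⇒i≡0 {f zero} (m+n≡0⇒m≡0 ∣ f zero ∣ eq)))
  (weightedSum-zero (λ j → f (suc j)) (λ j → w (suc j)) (m+n≡0⇒n≡0 ∣ f zero ∣ eq))

m+n≡1 : ∀ m {n} → m + n ≡ 1 → (m ≡ 1 × n ≡ 0) ⊎ (m ≡ 0 × n ≡ 1)
m+n≡1 zero    eq = inj₂ (refl , eq)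
m+n≡1 (suc m) eq = inj₁ (cong suc (m+n≡0⇒m≡0 m (suc-injective eq)) , m+n≡0⇒n≡0 m (suc-injective eq))

-- Naturals summing to 1 are all 0 except for a single 1, so one coefficient is a unit and the
-- others vanish. Its sign is unknown, hence the absolute values. The weights `w` are arbitrary so
-- that the induction can pass to the tail.
weightedSum-one : ∀ {m} (f w : Fin m → ℤ) →
  sum ℕ.+-0-rawMonoid (λ j → ∣ f j ∣) ≡ 1 →
  ∃[ i ] ∣ sum ℤ.+-0-rawMonoid (λ j → f j ℤ.* w j) ∣ ≡ ∣ w i ∣
weightedSum-one {suc m} f w eq with m+n≡1 ∣ f zero ∣ eq
... | inj₁ (head≡1 , tail≡0)
  rewrite weightedSum-zero (λ j → f (suc j)) (λ j → w (suc j)) tail≡0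
        | ℤₚ.+-identityʳ (f zero ℤ.* w zero)
        | ℤₚ.abs-* (f zero) (w zero)
        | head≡1
  = zero , *-identityˡ ∣ w zero ∣
... | inj₂ (head≡0 , tail≡1)
  rewrite ℤₚ.∣i∣≡0⇒i≡0 {f zero} head≡0
        | ℤₚ.+-identityˡ (sum ℤ.+-0-rawMonoid (λ j → f (suc j) ℤ.* w (suc j)))
  with i , eq′ ← weightedSum-one (λ j → f (suc j)) (λ j → w (suc j)) tail≡1
  = suc i , eq′

module _ {c} (C : Coefficients c) (b : ℕ) where
  open Coefficients C

  value-zero : weight ≡ 0 → value b ≡ 0ℤ
  value-zero = weightedSum-zero {bound} (λ j → ε (toℕ j)) (λ j → + (b ^ toℕ j))

  value-one : weight ≡ 1 → ∃[ j ] ∣ value b ∣ ≡ b ^ j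
  value-one eq
    with i , eq′ ← weightedSum-one {bound} (λ j → ε (toℕ j)) (λ j → + (b ^ toℕ j)) eq
    = toℕ i , eq′

module _ {n k} (r : Representation n k) where
  open Coefficients
  open Representation r

  len-zero⇒zero : len ≡ 0 → k ≡ 0
  len-zero⇒zero eq = ℤₚ.+-injective (trans represents (cong₂ ℤ._+_
    (value-zero binary 2 (m+n≡0⇒m≡0 (weight binary) eq))
    (value-zero n-ary n (m+n≡0⇒n≡0 (weight binary) eq))))

  len-one⇒power : len ≡ 1 → (∃[ j ] k ≡ 2 ^ j) ⊎ (∃[ j ] k ≡ n ^ j)
  len-one⇒power eq with m+n≡1 (weight binary) eq
  ... | inj₁ (bin≡1 , nary≡0) with j , eq′ ← value-one binary 2 bin≡1
    -- `∣ + k ∣` computes to `k`, so taking absolute values in `represents` discards the unknown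
    -- sign.
    = inj₁ (j , trans (cong ∣_∣ (trans represents (trans
        (cong (ℤ._+_ (value binary 2)) (value-zero n-ary n nary≡0))
        (ℤₚ.+-identityʳ (value binary 2))))) eq′)
  ... | inj₂ (bin≡0 , nary≡1) with j , eq′ ← value-one n-ary n nary≡1
    = inj₂ (j , trans (cong ∣_∣ (trans represents (trans
        (cong (ℤ._+ value n-ary n) (value-zero binary 2 bin≡0))
        (ℤₚ.+-identityˡ (value n-ary n))))) eq′)

-- A positive power is divisible by its base, and 2 does not divide 3. The exponent 0 would give
-- `3 ≡ 1`, which the coverage check dismisses.
3≢2^ : ∀ j → 3 ≢ 2 ^ j
3≢2^ (suc j) eq = from-no (2 ∣? 3) (subst (2 ∣_) (sym eq) (m∣m*n (2 ^ j)))

3≢n^ : ∀ {n} → 3 < n → ∀ j → 3 ≢ n ^ j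
3≢n^ {n} 3<n (suc j) eq = >⇒∤ 3<n (subst (n ∣_) (sym eq) (m∣m*n (n ^ j)))

-- Least significant digit first.
digit : List Bool → ℕ → ℤ
digit []           j       = 0ℤ
digit (false ∷ ds) zero    = 0ℤ
digit (true  ∷ ds) zero    = 1ℤ
digit (d     ∷ ds) (suc j) = digit ds j

digit-vanishing : ∀ ds j → length ds ≤ j → digit ds j ≡ 0ℤ
digit-vanishing []           j       _         = refl
digit-vanishing (false ∷ ds) (suc j) (s≤s ds≤j) = digit-vanishing ds j ds≤j
digit-vanishing (true  ∷ ds) (suc j) (s≤s ds≤j) = digit-vanishing ds j ds≤j

∣digit∣≤1 : ∀ ds j → ∣ digit ds j ∣ ≤ 1
∣digit∣≤1 []           j       = z≤n
∣digit∣≤1 (false ∷ ds) zero    = z≤n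
∣digit∣≤1 (true  ∷ ds) zero    = ≤-refl
∣digit∣≤1 (false ∷ ds) (suc j) = ∣digit∣≤1 ds j
∣digit∣≤1 (true  ∷ ds) (suc j) = ∣digit∣≤1 ds j

fromDigits : List Bool → Coefficients 1
fromDigits ds = record
  { ε = digit ds ; bound = length ds ; vanishing = digit-vanishing ds ; bounded = ∣digit∣≤1 ds }

noDigits : ∀ {c} → Coefficients c
noDigits = record { ε = λ _ → 0ℤ ; bound = 0 ; vanishing = λ _ _ → refl ; bounded = λ _ → z≤n }

-- With the `n`-ary part empty, one witness serves every `n`; for concrete digits the equation holds
-- by computation.
binaryRepresentation : ∀ {n k} ds → + k ≡ Coefficients.value (fromDigits ds) 2 →
  HasRepresentationOfLength n k (Coefficients.weight (fromDigits ds))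
binaryRepresentation ds eq =
  record { binary = fromDigits ds ; n-ary = noDigits ; represents = trans eq (sym (ℤₚ.+-identityʳ _)) }
  , +-identityʳ _

one-length-one : ∀ {n} → HasRepresentationOfLength n 1 1
one-length-one = binaryRepresentation (true ∷ []) refl

two-length-one : ∀ {n} → HasRepresentationOfLength n 2 1
two-length-one = binaryRepresentation (false ∷ true ∷ []) refl

three-length-two : ∀ {n} → HasRepresentationOfLength n 3 2
three-length-two = binaryRepresentation (true ∷ true ∷ []) refl

three-not-length-one : ∀ {n} → 3 < n → ¬ HasRepresentationOfLength n 3 1
three-not-length-one 3<n (r , eq) with len-one⇒power r eq
... | inj₁ (j , 3≡) = 3≢2^ j 3≡
... | inj₂ (j , 3≡) = 3≢n^ 3<n j 3≡

λ₂⟨1⟩≔1 : ∀ n → λ₂, n ⟨ 1 ⟩≔ 1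
-- `0 < k` unfolds to `1 ≤ k`, so positivity alone gives leastness.
λ₂⟨1⟩≔1 n = (z<s , one-length-one , shorter) , λ k 0<k _ → 0<k
  where
  shorter : ∀ l → l < 1 → ¬ HasRepresentationOfLength n 1 l
  shorter zero _ (r , eq) with () ← len-zero⇒zero r eq
  shorter (suc l) (s<s ())

-- The case `n = 3` has to be excluded: there 3 is the first power of `n` and has length 1.
λ₂⟨2⟩≔3 : ∀ n → 3 < n → λ₂, n ⟨ 2 ⟩≔ 3
λ₂⟨2⟩≔3 n 3<n = (z<s , three-length-two , shorter) , smallest
  where
  shorter : ∀ l → l < 2 → ¬ HasRepresentationOfLength n 3 l
  shorter 0 _ (r , eq) with () ← len-zero⇒zero r eq
  shorter 1 _ rep = three-not-length-one 3<n rep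
  shorter (suc (suc l)) (s<s (s<s ()))

  smallest : ∀ k → 0 < k → HasMinimalLength n k 2 → 3 ≤ k
  smallest 1 _ (_ , none) = contradiction one-length-one (none 1 ≤-refl)
  smallest 2 _ (_ , none) = contradiction two-length-one (none 1 ≤-refl)
  smallest (suc (suc (suc k))) _ _ = s≤s (s≤s (s≤s z≤n))

λ₂-functional : ∀ {n h u v} → λ₂, n ⟨ h ⟩≔ u → λ₂, n ⟨ h ⟩≔ v → u ≡ v
λ₂-functional ((0<u , minᵤ) , leastᵤ) ((0<v , minᵥ) , leastᵥ) =
  ≤-antisym (leastᵤ _ 0<v minᵥ) (leastᵥ _ 0<u minᵤ)

eventuallyConstant⇒limitPoint : ∀ {h v} M → (∀ n → M < n → λ₂, n ⟨ h ⟩≔ v) →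
  ∀ u → LimitPoint h u ⇔ u ≡ v
eventuallyConstant⇒limitPoint {h} {v} M λ≔v u = mk⇔ unique λ { refl → attained }
  where
  unique : LimitPoint h u → u ≡ v
  -- Asking for `suc M ≤ n` is asking for `M < n`, so both values are taken at the same `n`.
  unique limit with n , M<n , _ , _ , λ≔u ← limit (suc M) = λ₂-functional λ≔u (λ≔v n M<n)

  attained : LimitPoint h v
  attained N = n , ≤-trans (m≤m+n N (suc M)) K≤n , ≤-trans (s≤s (s≤s z≤n)) (m≤n+m 3 (2 * K)) , odd
             , λ≔v n (≤-trans (m≤n+m (suc M) N) K≤n)
    where
    K n : ℕ
    -- `K` is at least `N` and exceeds `M`. Then `2 * K + 3` is odd, at least `K`, and greater than
    -- 1 thanks to the summand 3, whose oddness also settles `odd`.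
    K = N + suc M
    n = 2 * K + 3

    K≤n : K ≤ n
    K≤n = ≤-trans (m≤n*m K 2) (m≤m+n (2 * K) 3)

    odd : 2 ∤ n
    odd 2∣n = from-no (2 ∣? 3) (∣m+n∣m⇒∣n 2∣n (m∣m*n K))

corollary1 : (∀ (v : ℕ) → LimitPoint 1 v ⇔ v ≡ 1) × (∀ (v : ℕ) → LimitPoint 2 v ⇔ v ≡ 3)
corollary1 = eventuallyConstant⇒limitPoint 0 (λ n _ → λ₂⟨1⟩≔1 n)
           , eventuallyConstant⇒limitPoint 3 λ₂⟨2⟩≔3
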